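{- Let $\mathcal{Q}$ be a small quantaloid and let $S\dashv T:\mathbb{D}\to\mathbb{C}$ be an adjunction of $\mathcal{Q}$-functors between $\mathcal{Q}$-categories $\mathbb{C},\mathbb{D}$. A $\mathcal{Q}$-category $\mathbb{X}$ is equivalent to $\mathrm{Fix}(TS)$ if, and only if, there exist essentially surjective $\mathcal{Q}$-functors $L:\mathbb{C}\to\mathbb{X}$ and $R:\mathbb{D}\to\mathbb{X}$ with $S_{\natural}=R^{\natural}\circ L_{\natural}$.
   Context: A quantaloid $\mathcal{Q}$ is a category whose hom-sets are complete lattices and whose composition $\circ$ preserves joins in each variable; small means it has a set $\mathcal{Q}_0$ of objects; $1_q$ denotes identities. A $\mathcal{Q}$-typed set is a set $A$ with a map $|\cdot|:A\to\mathcal{Q}_0$; maps preserving types are type-preserving. A $\mathcal{Q}$-category $\mathbb{A}$ is a $\mathcal{Q}$-typed set $\mathbb{A}_0$ with arrows $\mathbb{A}(x,y)\in\mathcal{Q}(|x|,|y|)$ such that $1_{|x|}\leq\mathbb{A}(x,x)$ and $\mathbb{A}(y,z)\circ\mathbb{A}(x,y)\leq\mathbb{A}(x,z)$. A $\mathcal{Q}$-subcategory is a subset of objects with the same hom-arrows. The underlying preorder: $x\leq y$ iff $|x|=|y|$ and $1_{|x|}\leq\mathbb{A}(x,y)$; $x\cong y$ means $x\leq y$ and $y\leq x$. A $\mathcal{Q}$-functor $F:\mathbb{A}\to\mathbb{B}$ is a type-preserving map $\mathbb{A}_0\to\mathbb{B}_0$ with $\mathbb{A}(x,x')\leq\mathbb{B}(Fx,Fx')$;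 $\mathcal{Q}$-functors are (pre)ordered pointwise, and $F\cong G$ means $F\le G$ and $G\le F$. $S\dashv T:\mathbb{D}\to\mathbb{C}$ means $\mathcal{Q}$-functors $S:\mathbb{C}\to\mathbb{D}$, $T:\mathbb{D}\to\mathbb{C}$ with $1_{\mathbb{C}}\leq TS$ and $ST\leq 1_{\mathbb{D}}$. $\mathrm{Fix}(TS)$ is the $\mathcal{Q}$-subcategory of $\mathbb{C}$ of objects $c$ with $TSc\cong c$. $F:\mathbb A\to\mathbb B$ is essentially surjective if every $y\in\mathbb{B}_0$ satisfies $y\cong Fx$ for some $x\in\mathbb A_0$. $\mathbb{A}$ and $\mathbb{B}$ are equivalent if there are $\mathcal{Q}$-functors $F:\mathbb{A}\to\mathbb{B}$, $G:\mathbb{B}\to\mathbb{A}$ with $GF\cong1_{\mathbb{A}}$, $FG\cong1_{\mathbb{B}}$. A $\mathcal{Q}$-distributor $\phi:\mathbb{A}\nrightarrow\mathbb{B}$ is a family of arrows $\phi(x,y):|x|\to|y|$ ($x\in\mathbb{A}_0,y\in\mathbb{B}_0$) with $\mathbb{B}(y,y')\circ\phi(x,y)\circ\mathbb{A}(x',x)\leq\phi(x',y')$; composition of $\phi:\mathbb{A}\nrightarrow\mathbb{B}$ and $\psi:\mathbb{B}\nrightarrow\mathbb{C}$ is $(\psi\circ\phi)(x,z)=\bigvee_{y\in\mathbb{B}_0}\psi(y,z)\circ\phi(x,y)$. For a $\mathcal{Q}$-functor $F:\mathbb{A}\to\mathbb{B}$, its graph $F_\natural:\mathbb{A}\nrightarrow\mathbb{B}$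 and cograph $F^\natural:\mathbb{B}\nrightarrow\mathbb{A}$ are $F_\natural(x,y)=\mathbb{B}(Fx,y)$, $F^\natural(y,x)=\mathbb{B}(y,Fx)$. -}

module Defs where

open import Level using (Level; _⊔_; suc; Lift; lift)
open import Data.Bool using (Bool; true; false)
open import Data.Product using (Σ; ∃; _×_; _,_; proj₁; proj₂)
open import Function.Base using (id; _∘_)
open import Relation.Binary.Bundles using (Poset)
open import Relation.Binary.PropositionalEquality using (_≡_; refl; sym; trans; subst; subst₂)

-- Subsets are presented as families indexed by sets of level ι.  The level
-- ι is kept independent of that of the carrier: predicatively, a poset with
-- joins of all families as large as its own carrier need not be available.
record CompleteLattice (c ℓ₁ ℓ₂ ι : Level) : Set (suc (c ⊔ ℓ₁ ⊔ ℓ₂ ⊔ ι)) where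
  field
    poset : Poset c ℓ₁ ℓ₂
  open Poset poset public
  field
    ⋁          : {I : Set ι} → (I → Carrier) → Carrier
    ⋁-upper    : {I : Set ι} (f : I → Carrier) → ∀ i → f i ≤ ⋁ f
    ⋁-least    : {I : Set ι} (f : I → Carrier) → ∀ u → (∀ i → f i ≤ u) → ⋁ f ≤ u
    ⋀          : {I : Set ι} → (I → Carrier) → Carrier
    ⋀-lower    : {I : Set ι} (f : I → Carrier) → ∀ i → ⋀ f ≤ f i
    ⋀-greatest : {I : Set ι} (f : I → Carrier) → ∀ l → (∀ i → l ≤ f i) → l ≤ ⋀ f

record Quantaloid (o c ℓ₁ ℓ₂ ι : Level) : Set (suc (o ⊔ c ⊔ ℓ₁ ⊔ ℓ₂ ⊔ ι)) where
  field
    Obj : Set o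
    Hom : Obj → Obj → CompleteLattice c ℓ₁ ℓ₂ ι

  module Hom {p q : Obj} = CompleteLattice (Hom p q)
  open Hom public using (_≈_; _≤_; ⋁; ⋁-upper; ⋁-least)

  Arr : Obj → Obj → Set c
  Arr p q = CompleteLattice.Carrier (Hom p q)

  infixr 9 _∙_
  field
    1[_] : ∀ q → Arr q q
    _∙_  : ∀ {p q r} → Arr q r → Arr p q → Arr p r

    ∙-cong    : ∀ {p q r} {g g′ : Arr q r} {f f′ : Arr p q} →
                g ≈ g′ → f ≈ f′ → g ∙ f ≈ g′ ∙ f′
    assoc     : ∀ {p q r s} (h : Arr r s) (g : Arr q r) (f : Arr p q) →
                (h ∙ g) ∙ f ≈ h ∙ (g ∙ f)
    identityˡ : ∀ {p q} (f : Arr p q) → 1[ q ] ∙ f ≈ f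
    identityʳ : ∀ {p q} (f : Arr p q) → f ∙ 1[ p ] ≈ f

    ∙-⋁-distribˡ : ∀ {p q r} {I : Set ι} (g : Arr q r) (f : I → Arr p q) →
                   g ∙ ⋁ f ≈ ⋁ (λ i → g ∙ f i)
    ∙-⋁-distribʳ : ∀ {p q r} {I : Set ι} (g : I → Arr q r) (f : Arr p q) →
                   ⋁ g ∙ f ≈ ⋁ (λ i → g i ∙ f)

  private
    pair : ∀ {p q} → Arr p q → Arr p q → Lift ι Bool → Arr p q
    pair f f′ (lift false) = f
    pair f f′ (lift true)  = f′

    ⋁-pair : ∀ {p q} {f f′ : Arr p q} → f ≤ f′ → ⋁ (pair f f′) ≈ f′
    ⋁-pair {f = f} {f′} f≤f′ = Hom.antisym
      (⋁-least (pair f f′) f′ (λ { (lift false) → f≤f′ ; (lift true) → Hom.refl }))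
      (⋁-upper (pair f f′) (lift true))

  ∙-monoʳ : ∀ {p q r} (g : Arr q r) {f f′ : Arr p q} → f ≤ f′ → g ∙ f ≤ g ∙ f′
  ∙-monoʳ g {f} {f′} f≤f′ = Hom.trans
    (⋁-upper (λ i → g ∙ pair f f′ i) (lift false))
    (Hom.reflexive (Hom.Eq.trans (Hom.Eq.sym (∙-⋁-distribˡ g (pair f f′)))
                                 (∙-cong Hom.Eq.refl (⋁-pair f≤f′))))

  ∙-monoˡ : ∀ {p q r} {g g′ : Arr q r} (f : Arr p q) → g ≤ g′ → g ∙ f ≤ g′ ∙ f
  ∙-monoˡ {g = g} {g′} f g≤g′ = Hom.trans
    (⋁-upper (λ i → pair g g′ i ∙ f) (lift false))
    (Hom.reflexive (Hom.Eq.trans (Hom.Eq.sym (∙-⋁-distribʳ (pair g g′) f))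
                                 (∙-cong (⋁-pair g≤g′) Hom.Eq.refl)))

  ∙-mono : ∀ {p q r} {g g′ : Arr q r} {f f′ : Arr p q} →
           g ≤ g′ → f ≤ f′ → g ∙ f ≤ g′ ∙ f′
  ∙-mono {g′ = g′} {f = f} g≤g′ f≤f′ = Hom.trans (∙-monoˡ f g≤g′) (∙-monoʳ g′ f≤f′)

  -- Transport of arrows along equalities of objects, needed because type
  -- preservation |F x| ≡ |x| is only propositional.  By axiom K the result
  -- does not depend on the equality proofs.
  cast : ∀ {p p′ q q′} → p ≡ p′ → q ≡ q′ → Arr p q → Arr p′ q′
  cast = subst₂ Arr

  cast-mono : ∀ {p p′ q q′} (d : p ≡ p′) (e : q ≡ q′) {f g : Arr p q} →
              f ≤ g → cast d e f ≤ cast d e g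
  cast-mono refl refl f≤g = f≤g

  cast-∙ : ∀ {p p′ q q′ r r′} (d : p ≡ p′) (e : q ≡ q′) (k : r ≡ r′)
           (g : Arr q r) (f : Arr p q) →
           cast e k g ∙ cast d e f ≡ cast d k (g ∙ f)
  cast-∙ refl refl refl g f = refl

  cast-trans : ∀ {p p′ p″ q q′ q″} (d : p ≡ p′) (d′ : p′ ≡ p″)
               (e : q ≡ q′) (e′ : q′ ≡ q″) (f : Arr p q) →
               cast d′ e′ (cast d e f) ≡ cast (trans d d′) (trans e e′) f
  cast-trans refl refl refl refl f = refl

record QCategory {o c ℓ₁ ℓ₂ ι} (Q : Quantaloid o c ℓ₁ ℓ₂ ι) (a : Level)
       : Set (o ⊔ c ⊔ ℓ₂ ⊔ suc a) where
  open Quantaloid Q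
  field
    Ob   : Set a
    ∣_∣  : Ob → Obj
    hom  : ∀ x y → Arr ∣ x ∣ ∣ y ∣
    unit : ∀ x → 1[ ∣ x ∣ ] ≤ hom x x
    comp : ∀ x y z → hom y z ∙ hom x y ≤ hom x z

module _ {o c ℓ₁ ℓ₂ ι} {Q : Quantaloid o c ℓ₁ ℓ₂ ι} where
  open Quantaloid Q
  open QCategory using (Ob; hom; unit; comp)

  infix 4 _[_≤_] _[_≅_]

  _[_≤_] : ∀ {a} (A : QCategory Q a) → Ob A → Ob A → Set (o ⊔ ℓ₂)
  A [ x ≤ y ] = Σ (∣ x ∣ ≡ ∣ y ∣) λ e → 1[ ∣ x ∣ ] ≤ cast refl (sym e) (hom A x y)
    where open QCategory A using (∣_∣)

  _[_≅_] : ∀ {a} (A : QCategory Q a) → Ob A → Ob A → Set (o ⊔ ℓ₂)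
  A [ x ≅ y ] = A [ x ≤ y ] × A [ y ≤ x ]

  -- A subset of objects is a predicate.  Distinct proofs of P x give
  -- isomorphic copies of the object x, which is harmless up to equivalence.
  subcategory : ∀ {a p} (A : QCategory Q a) → (Ob A → Set p) → QCategory Q (a ⊔ p)
  subcategory A P = record
    { Ob   = ∃ P
    ; ∣_∣  = λ x → ∣ proj₁ x ∣
    ; hom  = λ x y → hom A (proj₁ x) (proj₁ y)
    ; unit = λ x → unit A (proj₁ x)
    ; comp = λ x y z → comp A (proj₁ x) (proj₁ y) (proj₁ z)
    }
    where open QCategory A using (∣_∣)

  record QFunctor {a b} (A : QCategory Q a) (B : QCategory Q b)
         : Set (o ⊔ ℓ₂ ⊔ a ⊔ b) where
    private
      module A = QCategory A
      module B = QCategory B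
    field
      map   : A.Ob → B.Ob
      typed : ∀ x → B.∣ map x ∣ ≡ A.∣ x ∣
      mono  : ∀ x x′ → A.hom x x′ ≤ cast (typed x) (typed x′) (B.hom (map x) (map x′))

  open QFunctor using (map; typed; mono)

  idF : ∀ {a} {A : QCategory Q a} → QFunctor A A
  idF = record { map = id ; typed = λ _ → refl ; mono = λ _ _ → Hom.refl }

  infixr 9 _∘F_

  _∘F_ : ∀ {a b d} {A : QCategory Q a} {B : QCategory Q b} {D : QCategory Q d} →
         QFunctor B D → QFunctor A B → QFunctor A D
  _∘F_ {A = A} {B} {D} G F = record
    { map   = map G ∘ map F
    ; typed = λ x → trans (typed G (map F x)) (typed F x)
    ; mono  = λ x x′ → subst (hom A x x′ ≤_)
        (cast-trans (typed G (map F x)) (typed F x) (typed G (map F x′)) (typed F x′)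
                    (hom D (map G (map F x)) (map G (map F x′))))
        (Hom.trans (mono F x x′)
                   (cast-mono (typed F x) (typed F x′) (mono G (map F x) (map F x′))))
    }

  infix 4 _≤F_ _≅F_ _⊣_ _≃_ _≈D_

  _≤F_ : ∀ {a b} {A : QCategory Q a} {B : QCategory Q b} →
         QFunctor A B → QFunctor A B → Set (o ⊔ ℓ₂ ⊔ a)
  _≤F_ {B = B} F G = ∀ x → B [ map F x ≤ map G x ]

  _≅F_ : ∀ {a b} {A : QCategory Q a} {B : QCategory Q b} →
         QFunctor A B → QFunctor A B → Set (o ⊔ ℓ₂ ⊔ a)
  F ≅F G = F ≤F G × G ≤F F

  _⊣_ : ∀ {a b} {C : QCategory Q a} {D : QCategory Q b} →
        QFunctor C D → QFunctor D C → Set (o ⊔ ℓ₂ ⊔ a ⊔ b)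
  S ⊣ T = idF ≤F T ∘F S × S ∘F T ≤F idF

  Fix : ∀ {a} {C : QCategory Q a} → QFunctor C C → QCategory Q (o ⊔ ℓ₂ ⊔ a)
  Fix {C = C} H = subcategory C (λ x → C [ map H x ≅ x ])

  EssentiallySurjective : ∀ {a b} {A : QCategory Q a} {B : QCategory Q b} →
                          QFunctor A B → Set (o ⊔ ℓ₂ ⊔ a ⊔ b)
  EssentiallySurjective {B = B} F = ∀ y → ∃ λ x → B [ y ≅ map F x ]

  _≃_ : ∀ {a b} → QCategory Q a → QCategory Q b → Set (o ⊔ ℓ₂ ⊔ a ⊔ b)
  A ≃ B = Σ (QFunctor A B) λ F → Σ (QFunctor B A) λ G → (G ∘F F ≅F idF) × (F ∘F G ≅F idF)

  record QDistributor {a b} (A : QCategory Q a) (B : QCategory Q b)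
         : Set (c ⊔ ℓ₂ ⊔ a ⊔ b) where
    private
      module A = QCategory A
      module B = QCategory B
    field
      at     : ∀ x y → Arr A.∣ x ∣ B.∣ y ∣
      action : ∀ x x′ y y′ → B.hom y y′ ∙ at x y ∙ A.hom x′ x ≤ at x′ y′

  open QDistributor using (at; action)

  _≈D_ : ∀ {a b} {A : QCategory Q a} {B : QCategory Q b} →
         QDistributor A B → QDistributor A B → Set (ℓ₁ ⊔ a ⊔ b)
  φ ≈D ψ = ∀ x y → at φ x y ≈ at ψ x y

  private
    actˡ : ∀ {a b} {A : QCategory Q a} {B : QCategory Q b} (φ : QDistributor A B) →
           ∀ x y y′ → hom B y y′ ∙ at φ x y ≤ at φ x y′
    actˡ {A = A} {B} φ x y y′ = Hom.trans
      (∙-monoʳ (hom B y y′)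
        (Hom.trans (Hom.reflexive (Hom.Eq.sym (identityʳ (at φ x y))))
                   (∙-monoʳ (at φ x y) (unit A x))))
      (action φ x x y y′)

    actʳ : ∀ {a b} {A : QCategory Q a} {B : QCategory Q b} (φ : QDistributor A B) →
           ∀ x x′ y → at φ x y ∙ hom A x′ x ≤ at φ x′ y
    actʳ {A = A} {B} φ x x′ y = Hom.trans
      (Hom.trans (Hom.reflexive (Hom.Eq.sym (identityˡ (at φ x y ∙ hom A x′ x))))
                 (∙-monoˡ (at φ x y ∙ hom A x′ x) (unit B y)))
      (action φ x x′ y y)

  -- The join ranges over the objects of B, whence their level ι.
  infixr 9 _⊙_

  _⊙_ : ∀ {a d} {A : QCategory Q a} {B : QCategory Q ι} {D : QCategory Q d} →
        QDistributor B D → QDistributor A B → QDistributor A D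
  _⊙_ {A = A} {B} {D} ψ φ = record
    { at     = λ x z → ⋁ (λ y → at ψ y z ∙ at φ x y)
    ; action = λ x x′ z z′ →
        let f = λ y → at ψ y z ∙ at φ x y
            h = hom D z z′
            k = hom A x′ x
        in Hom.trans
             (Hom.reflexive (Hom.Eq.trans
               (∙-cong Hom.Eq.refl (∙-⋁-distribʳ f k))
               (∙-⋁-distribˡ h (λ y → f y ∙ k))))
             (⋁-least _ _ λ y → Hom.trans
               (Hom.reflexive (Hom.Eq.trans
                 (∙-cong Hom.Eq.refl (assoc (at ψ y z) (at φ x y) k))
                 (Hom.Eq.sym (assoc h (at ψ y z) (at φ x y ∙ k)))))
               (Hom.trans (∙-mono (actˡ ψ y z z′) (actʳ φ x x′ y))
                          (⋁-upper (λ y → at ψ y z′ ∙ at φ x′ y) y)))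
    }

  private
    comp₃ : ∀ {b} (B : QCategory Q b) → ∀ w x y z →
            hom B y z ∙ hom B x y ∙ hom B w x ≤ hom B w z
    comp₃ B w x y z = Hom.trans (∙-monoʳ (hom B y z) (comp B w x y)) (comp B w y z)

    cast-∙₃ : ∀ {p p′ q q′ r r′ s s′} (d : p ≡ p′) (e : q ≡ q′) (j : r ≡ r′) (k : s ≡ s′)
              (h : Arr r s) (g : Arr q r) (f : Arr p q) →
              cast j k h ∙ cast e j g ∙ cast d e f ≡ cast d k (h ∙ g ∙ f)
    cast-∙₃ refl refl refl refl h g f = refl

  graph : ∀ {a b} {A : QCategory Q a} {B : QCategory Q b} → QFunctor A B → QDistributor A B
  graph {A = A} {B} F = record
    { at     = λ x y → cast (typed F x) refl (hom B (map F x) y)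
    ; action = λ x x′ y y′ → Hom.trans
        (∙-monoʳ (hom B y y′)
          (∙-monoʳ (cast (typed F x) refl (hom B (map F x) y)) (mono F x′ x)))
        (subst (_≤ cast (typed F x′) refl (hom B (map F x′) y′))
          (sym (cast-∙₃ (typed F x′) (typed F x) refl refl
                 (hom B y y′) (hom B (map F x) y) (hom B (map F x′) (map F x))))
          (cast-mono (typed F x′) refl (comp₃ B (map F x′) (map F x) y y′)))
    }

  cograph : ∀ {a b} {A : QCategory Q a} {B : QCategory Q b} → QFunctor A B → QDistributor B A
  cograph {A = A} {B} F = record
    { at     = λ y x → cast refl (typed F x) (hom B y (map F x))
    ; action = λ y y′ x x′ → Hom.trans
        (∙-monoˡ (cast refl (typed F x) (hom B y (map F x)) ∙ hom B y′ y) (mono F x x′))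
        (subst (_≤ cast refl (typed F x′) (hom B y′ (map F x′)))
          (sym (cast-∙₃ refl refl (typed F x) (typed F x′)
                 (hom B (map F x) (map F x′)) (hom B y (map F x)) (hom B y′ y)))
          (cast-mono refl (typed F x′) (comp₃ B y′ y (map F x) (map F x′))))
    }

{-# OPTIONS --safe #-}
module Submission where

-- Everything rests on one observation: by the co-Yoneda lemma the composite
-- R^♮ ∘ L_♮ is the family X(Lc, Rd), so the condition S_♮ = R^♮ ∘ L_♮ says
--
--     X(Lc, Rd)  =  D(Sc, d)  =  C(c, Td)      for all c in C and d in D,
--
-- the second equality being the adjunction.
--
-- Given an equivalence F : X → Fix(TS), G : Fix(TS) → X, put L = G(TS-) and
-- R = G(T-).  Every fixed point c is isomorphic to TSc, hence both L and R are
-- essentially surjective.  As G is fully faithful, X(Lc, Rd) is C(TSc, Td),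
-- and this is D(Sc, d) because TS is a closure operator with fixed points Td
-- (`unit-transpose`).
--
-- Conversely, given L and R, essential surjectivity forces LT ≅ R
-- (`LT≅R` in `FromFactorization`).  Choose for each x an object d with Rd ≅ x and
-- send x to Td.  This is a functor since
--
--     X(x, x′) = X(Rd, Rd′) = X(LTd, Rd′) = C(Td, Td′),
--
-- and its inverse is the restriction of L to Fix(TS).
--
-- Type preservation holds only up to propositional equality, so homs must be
-- transported.  To keep transports out of the argument, it is carried out with
-- objects bundled with a proof that they have a given type p (`Typed`);
-- by axiom K the choice of that proof is immaterial.

open import Defs
open import Level using (_⊔_)
open import Data.Product using (Σ-syntax; _×_; _,_; proj₁; proj₂; swap)
open import Function.Bundles using (_⇔_; mk⇔)
open import Relation.Binary.PropositionalEquality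
  using (_≡_; refl; sym; trans; subst; cong)
open import Relation.Binary.PropositionalEquality.WithK using (≡-irrelevant)

module _ {o v ℓ₁ ℓ₂ ι} {Q : Quantaloid o v ℓ₁ ℓ₂ ι} where
  open Quantaloid Q
  open QCategory using (Ob; hom; unit; comp)
  open QFunctor using (map; typed; mono)

  -- Typed objects and their homs

  -- The fibre over p of the typing map of A, up to propositional equality.
  record Typed {a} (A : QCategory Q a) (p : Obj) : Set (o ⊔ a) where
    constructor _∶_
    field
      ob   : Ob A
      type : QCategory.∣_∣ A ob ≡ p

  open Typed

  infix 5 _∶_

  -- An object with its own type.
  ⌜_⌝ : ∀ {a} {A : QCategory Q a} (x : Ob A) → Typed A (QCategory.∣_∣ A x)
  ⌜ x ⌝ = x ∶ refl

  -- The hom of two typed objects, transported to their declared types.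
  infix 10 _⟨_,_⟩
  _⟨_,_⟩ : ∀ {a} (A : QCategory Q a) {p q} → Typed A p → Typed A q → Arr p q
  A ⟨ x , y ⟩ = cast (type x) (type y) (hom A (ob x) (ob y))

  -- The underlying preorder on objects of a common type.  As a record it
  -- determines x and y, which the transported hom does not.
  infix 4 _⊑_ _≋_
  record _⊑_ {a} {A : QCategory Q a} {p} (x y : Typed A p) : Set ℓ₂ where
    constructor below
    field
      unit≤hom : 1[ p ] ≤ A ⟨ x , y ⟩

  open _⊑_

  -- Isomorphism of objects of a common type.
  _≋_ : ∀ {a} {A : QCategory Q a} {p} → Typed A p → Typed A p → Set ℓ₂
  x ≋ y = (x ⊑ y) × (y ⊑ x)

  -- The action of a functor on typed objects.
  infixr 9 _·_
  _·_ : ∀ {a b} {A : QCategory Q a} {B : QCategory Q b} {p} →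
        QFunctor A B → Typed A p → Typed B p
  F · x = map F (ob x) ∶ trans (typed F (ob x)) (type x)

  module _ {a} {A : QCategory Q a} where
    open QCategory A using (∣_∣)

    compAt : ∀ {p q r} (x : Typed A p) (y : Typed A q) (z : Typed A r) →
             A ⟨ y , z ⟩ ∙ A ⟨ x , y ⟩ ≤ A ⟨ x , z ⟩
    compAt (x ∶ refl) (y ∶ refl) (z ∶ refl) = comp A x y z

    -- The type proof is immaterial.
    ⊑-same : ∀ {p} {x : Ob A} (e e′ : ∣ x ∣ ≡ p) → _⊑_ {A = A} (x ∶ e) (x ∶ e′)
    ⊑-same refl refl = below (unit A _)

    ⊑-refl : ∀ {p} {x : Typed A p} → x ⊑ x
    ⊑-refl {x = x} = ⊑-same (type x) (type x)

    hom-monoʳ : ∀ {p q} (x : Typed A p) {y y′ : Typed A q} → y ⊑ y′ →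
                A ⟨ x , y ⟩ ≤ A ⟨ x , y′ ⟩
    hom-monoʳ x {y} {y′} y⊑y′ = Hom.trans
      (Hom.reflexive (Hom.Eq.sym (identityˡ _)))
      (Hom.trans (∙-monoˡ _ (unit≤hom y⊑y′)) (compAt x y y′))

    hom-monoˡ : ∀ {p q} {x x′ : Typed A p} (y : Typed A q) → x′ ⊑ x →
                A ⟨ x , y ⟩ ≤ A ⟨ x′ , y ⟩
    hom-monoˡ {x = x} {x′} y x′⊑x = Hom.trans
      (Hom.reflexive (Hom.Eq.sym (identityʳ _)))
      (Hom.trans (∙-monoʳ _ (unit≤hom x′⊑x)) (compAt x′ x y))

    hom-mono : ∀ {p q} {x x′ : Typed A p} {y y′ : Typed A q} → x′ ⊑ x → y ⊑ y′ →
               A ⟨ x , y ⟩ ≤ A ⟨ x′ , y′ ⟩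
    hom-mono {x′ = x′} {y = y} x′⊑x y⊑y′ = Hom.trans (hom-monoˡ y x′⊑x) (hom-monoʳ x′ y⊑y′)

    ⊑-trans : ∀ {p} {x y z : Typed A p} → x ⊑ y → y ⊑ z → x ⊑ z
    ⊑-trans {x = x} x⊑y y⊑z = below (Hom.trans (unit≤hom x⊑y) (hom-monoʳ x y⊑z))

    ≋-trans : ∀ {p} {x y z : Typed A p} → x ≋ y → y ≋ z → x ≋ z
    ≋-trans (x⊑y , y⊑x) (y⊑z , z⊑y) = ⊑-trans x⊑y y⊑z , ⊑-trans z⊑y y⊑x

    -- The preorder A [_≤_] agrees with ⊑, whatever the type proofs.
    ⊑⇒≤ : ∀ {p} {x y : Typed A p} → x ⊑ y → A [ ob x ≤ ob y ]
    ⊑⇒≤ {x = x ∶ refl} {y ∶ e} (below x⊑y) = sym e ,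
      subst (λ e → 1[ ∣ x ∣ ] ≤ cast refl e (hom A x y)) (≡-irrelevant e _) x⊑y

    ≤⇒⊑ : ∀ {p} {x y : Typed A p} → A [ ob x ≤ ob y ] → x ⊑ y
    ≤⇒⊑ {x = x ∶ refl} {y ∶ e} (d , x≤y) =
      below (subst (λ e → 1[ ∣ x ∣ ] ≤ cast refl e (hom A x y)) (≡-irrelevant _ e) x≤y)

    ≋⇒≅ : ∀ {p} {x y : Typed A p} → x ≋ y → A [ ob x ≅ ob y ]
    ≋⇒≅ (x⊑y , y⊑x) = ⊑⇒≤ x⊑y , ⊑⇒≤ y⊑x

    ≅⇒≋ : ∀ {p} {x y : Typed A p} → A [ ob x ≅ ob y ] → x ≋ y
    ≅⇒≋ (x≤y , y≤x) = ≤⇒⊑ x≤y , ≤⇒⊑ y≤x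

    -- Co-Yoneda: the join of composites through arbitrary intermediate
    -- objects is attained at the intermediate object y.
    hom-factors : ∀ {p q} (x : Typed A p) (y : Typed A q) →
                  A ⟨ x , y ⟩ ≤ A ⟨ ⌜ ob y ⌝ , y ⟩ ∙ A ⟨ x , ⌜ ob y ⌝ ⟩
    hom-factors x (y ∶ refl) = Hom.trans
      (Hom.reflexive (Hom.Eq.sym (identityˡ _)))
      (∙-monoˡ _ (unit A y))

  -- Functors on typed objects

  module _ {a b} {A : QCategory Q a} {B : QCategory Q b} where

    monoAt : ∀ {p q} (F : QFunctor A B) (x : Typed A p) (y : Typed A q) →
             A ⟨ x , y ⟩ ≤ B ⟨ F · x , F · y ⟩
    monoAt F (x ∶ d) (y ∶ e) = subst (cast d e (hom A x y) ≤_)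
      (cast-trans (typed F x) d (typed F y) e _) (cast-mono d e (mono F x y))

    ·-mono : ∀ {p} (F : QFunctor A B) {x y : Typed A p} → x ⊑ y → F · x ⊑ F · y
    ·-mono F {x} {y} (below x⊑y) = below (Hom.trans x⊑y (monoAt F x y))

    ·-cong : ∀ {p} (F : QFunctor A B) {x y : Typed A p} → x ≋ y → F · x ≋ F · y
    ·-cong F (x⊑y , y⊑x) = ·-mono F x⊑y , ·-mono F y⊑x

    -- Essential surjectivity on typed objects.
    cover : ∀ {p} (F : QFunctor A B) → EssentiallySurjective F →
            (y : Typed B p) → Σ[ x ∈ Typed A p ] y ≋ F · x
    cover F surj (y ∶ refl) with surj y
    ... | x , y≅Fx@((e , _) , _) = (x ∶ trans (sym (typed F x)) (sym e)) , ≅⇒≋ y≅Fx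

    graph-at : ∀ (F : QFunctor A B) x y →
               QDistributor.at (graph F) x y ≡ B ⟨ F · ⌜ x ⌝ , ⌜ y ⌝ ⟩
    graph-at F x y =
      cong (λ e → cast e refl (hom B (map F x) y)) (≡-irrelevant _ _)

    cograph-at : ∀ (F : QFunctor A B) x y →
                 QDistributor.at (cograph F) y x ≡ B ⟨ ⌜ y ⌝ , F · ⌜ x ⌝ ⟩
    cograph-at F x y =
      cong (λ e → cast refl e (hom B y (map F x))) (≡-irrelevant _ _)

  -- A functor with a left inverse up to isomorphism is fully faithful.
  reflectHom : ∀ {a b} {A : QCategory Q a} {B : QCategory Q b} {p q}
               (G : QFunctor A B) (F : QFunctor B A) → F ∘F G ≅F idF →
               (x : Typed A p) (y : Typed A q) →
               B ⟨ G · x , G · y ⟩ ≤ A ⟨ x , y ⟩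
  reflectHom {A = A} G F (FG≤1 , 1≤FG) x y = Hom.trans
    (monoAt F (G · x) (G · y))
    (hom-mono {A = A} (≤⇒⊑ (1≤FG (ob x))) (≤⇒⊑ (FG≤1 (ob y))))

  -- The join over the objects of X computing R^♮ ∘ L_♮ is X(Lc, Rd).
  cograph⊙graph : ∀ {a b} {C : QCategory Q a} {D : QCategory Q b} {X : QCategory Q ι}
                  (L : QFunctor C X) (R : QFunctor D X) → ∀ c d →
                  QDistributor.at (cograph R ⊙ graph L) c d
                    ≈ X ⟨ L · ⌜ c ⌝ , R · ⌜ d ⌝ ⟩
  cograph⊙graph {X = X} L R c d = Hom.antisym
    (⋁-least _ _ λ x → Hom.trans (Hom.reflexive (term x))
                                 (compAt (L · ⌜ c ⌝) ⌜ x ⌝ (R · ⌜ d ⌝)))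
    (Hom.trans (hom-factors (L · ⌜ c ⌝) (R · ⌜ d ⌝))
      (Hom.trans (Hom.reflexive (Hom.Eq.sym (term (map R d)))) (⋁-upper _ (map R d))))
    where
    term : ∀ x → QDistributor.at (cograph R) x d ∙ QDistributor.at (graph L) c x
                   ≈ X ⟨ ⌜ x ⌝ , R · ⌜ d ⌝ ⟩ ∙ X ⟨ L · ⌜ c ⌝ , ⌜ x ⌝ ⟩
    term x = ∙-cong (Hom.Eq.reflexive (cograph-at R d x))
                    (Hom.Eq.reflexive (graph-at L c x))

  -- Full subcategories

  module _ {b p} {B : QCategory Q b} {P : Ob B → Set p} where

    inclusion : QFunctor (subcategory B P) B
    inclusion = record { map = proj₁ ; typed = λ _ → refl ; mono = λ _ _ → Hom.refl }

    corestrict : ∀ {a} {A : QCategory Q a} (F : QFunctor A B) →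
                 (∀ x → P (map F x)) → QFunctor A (subcategory B P)
    corestrict F PF = record
      { map = λ x → map F x , PF x ; typed = typed F ; mono = mono F }

  -- The adjunction

  module Adjunction {a b} {C : QCategory Q a} {D : QCategory Q b}
                    (S : QFunctor C D) (T : QFunctor D C) (S⊣T : S ⊣ T) where

    η : ∀ {p} (c : Typed C p) → c ⊑ T · S · c
    η c = ≤⇒⊑ (proj₁ S⊣T (ob c))

    ε : ∀ {p} (d : Typed D p) → S · T · d ⊑ d
    ε d = ≤⇒⊑ (proj₂ S⊣T (ob d))

    transpose : ∀ {p q} (c : Typed C p) (d : Typed D q) →
                D ⟨ S · c , d ⟩ ≤ C ⟨ c , T · d ⟩
    transpose c d = Hom.trans (monoAt T (S · c) d) (hom-monoˡ (T · d) (η c))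

    untranspose : ∀ {p q} (c : Typed C p) (d : Typed D q) →
                  C ⟨ c , T · d ⟩ ≤ D ⟨ S · c , d ⟩
    untranspose c d = Hom.trans (monoAt S c (T · d)) (hom-monoʳ (S · c) (ε d))

    -- Homs into objects Td do not distinguish c from its closure TSc.
    unit-transpose : ∀ {p q} (c : Typed C p) (d : Typed D q) →
                     D ⟨ S · c , d ⟩ ≈ C ⟨ T · S · c , T · d ⟩
    unit-transpose c d = Hom.antisym
      (monoAt T (S · c) d)
      (Hom.trans (hom-monoˡ (T · d) (η c)) (untranspose c d))

    T-fixed : ∀ {p} (d : Typed D p) → T · S · T · d ≋ T · d
    T-fixed d = ·-mono T (ε d) , η (T · d)

    T-fixed′ : ∀ d → C [ map (T ∘F S) (map T d) ≅ map T d ]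
    T-fixed′ d = ≋⇒≅ (T-fixed ⌜ d ⌝)

    -- T, and hence also TS, takes values in fixed points.
    toFix : QFunctor D (Fix (T ∘F S))
    toFix = corestrict T T-fixed′

  -- From an equivalence to a factorization

  module FromEquivalence {a b} {C : QCategory Q a} {D : QCategory Q b}
                         (S : QFunctor C D) (T : QFunctor D C) (S⊣T : S ⊣ T)
                         {X : QCategory Q ι}
                         (F : QFunctor X (Fix (T ∘F S))) (G : QFunctor (Fix (T ∘F S)) X)
                         (GF≅1 : G ∘F F ≅F idF) (FG≅1 : F ∘F G ≅F idF) where
    open Adjunction S T S⊣T

    R : QFunctor D X
    R = G ∘F toFix

    L : QFunctor C X
    L = R ∘F S

    L-surjective : EssentiallySurjective L
    L-surjective x = ob c , ≋⇒≅ x≋Lc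
      where
      -- The underlying object of the fixed point Fx.
      c : Typed C (QCategory.∣_∣ X x)
      c = inclusion · F · ⌜ x ⌝

      TSc≋Fx : toFix · S · c ≋ F · ⌜ x ⌝
      TSc≋Fx = ≅⇒≋ (proj₂ (map F x))

      x≋Lc : ⌜ x ⌝ ≋ G · toFix · S · c
      x≋Lc = ≋-trans (swap (≅⇒≋ (proj₁ GF≅1 x , proj₂ GF≅1 x))) (·-cong G (swap TSc≋Fx))

    R-surjective : EssentiallySurjective R
    R-surjective x with L-surjective x
    ... | c , x≅Lc = map S c , x≅Lc

    homs-agree : ∀ {p q} (c : Typed C p) (d : Typed D q) →
                 D ⟨ S · c , d ⟩ ≈ X ⟨ G · toFix · S · c , G · toFix · d ⟩
    homs-agree c d = Hom.Eq.trans (unit-transpose c d) (Hom.antisym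
      (monoAt G (toFix · S · c) (toFix · d))
      (reflectHom G F FG≅1 (toFix · S · c) (toFix · d)))

    factorization : graph S ≈D cograph R ⊙ graph L
    factorization c d = Hom.Eq.trans
      (Hom.Eq.trans (Hom.Eq.reflexive (graph-at S c d)) (homs-agree ⌜ c ⌝ ⌜ d ⌝))
      (Hom.Eq.trans same (Hom.Eq.sym (cograph⊙graph L R c d)))
      where
      -- The two sides differ only in their type proofs.
      same : X ⟨ G · toFix · S · ⌜ c ⌝ , G · toFix · ⌜ d ⌝ ⟩ ≈ X ⟨ L · ⌜ c ⌝ , R · ⌜ d ⌝ ⟩
      same = Hom.antisym (hom-mono {A = X} (⊑-same _ _) (⊑-same _ _))
                         (hom-mono {A = X} (⊑-same _ _) (⊑-same _ _))

  -- From a factorization to an equivalence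

  module FromFactorization {a b} {C : QCategory Q a} {D : QCategory Q b}
                           (S : QFunctor C D) (T : QFunctor D C) (S⊣T : S ⊣ T)
                           {X : QCategory Q ι}
                           (L : QFunctor C X) (R : QFunctor D X)
                           (L-surjective : EssentiallySurjective L)
                           (R-surjective : EssentiallySurjective R)
                           (factorization : graph S ≈D cograph R ⊙ graph L) where
    open Adjunction S T S⊣T

    homs-agree : ∀ {p q} (c : Typed C p) (d : Typed D q) →
                 D ⟨ S · c , d ⟩ ≈ X ⟨ L · c , R · d ⟩
    homs-agree (c ∶ refl) (d ∶ refl) = Hom.Eq.trans
      (Hom.Eq.reflexive (sym (graph-at S c d)))
      (Hom.Eq.trans (factorization c d) (cograph⊙graph L R c d))

    fromX : ∀ {p q} (c : Typed C p) (d : Typed D q) →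
            X ⟨ L · c , R · d ⟩ ≤ C ⟨ c , T · d ⟩
    fromX c d = Hom.trans (Hom.reflexive (Hom.Eq.sym (homs-agree c d))) (transpose c d)

    toX : ∀ {p q} (c : Typed C p) (d : Typed D q) →
          C ⟨ c , T · d ⟩ ≤ X ⟨ L · c , R · d ⟩
    toX c d = Hom.trans (untranspose c d) (Hom.reflexive (homs-agree c d))

    -- The objectwise form of the two inequalities above: c ≤ Td if and only if
    -- Lc ≤ Rd.
    L⊑R : ∀ {p} {c : Typed C p} {d : Typed D p} → c ⊑ T · d → L · c ⊑ R · d
    L⊑R {c = c} {d} (below c⊑Td) = below (Hom.trans c⊑Td (toX c d))

    ⊑T : ∀ {p} {c : Typed C p} {d : Typed D p} → L · c ⊑ R · d → c ⊑ T · d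
    ⊑T {c = c} {d} (below Lc⊑Rd) = below (Hom.trans Lc⊑Rd (fromX c d))

    -- From Td ≤ Td follows LTd ≤ Rd.  Conversely, an object c with Rd ≅ Lc lies
    -- below Td, whence Rd ≅ Lc ≤ LTd.
    LT≅R : ∀ {p} (d : Typed D p) → L · T · d ≋ R · d
    LT≅R d with cover L L-surjective (R · d)
    ... | c , Rd⊑Lc , Lc⊑Rd =
      L⊑R ⊑-refl , ⊑-trans Rd⊑Lc (·-mono L (⊑T Lc⊑Rd))

    -- A chosen object of D which R sends to x, up to isomorphism.
    δ : ∀ x → Typed D (QCategory.∣_∣ X x)
    δ x = proj₁ (cover R R-surjective ⌜ x ⌝)

    x≋Rδ : ∀ x → ⌜ x ⌝ ≋ R · δ x
    x≋Rδ x = proj₂ (cover R R-surjective ⌜ x ⌝)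

    LTδ≋x : ∀ x → L · T · δ x ≋ ⌜ x ⌝
    LTδ≋x x = ≋-trans (LT≅R (δ x)) (swap (x≋Rδ x))

    Tδ : QFunctor X C
    Tδ = record
      { map   = λ x → ob (T · δ x)
      ; typed = λ x → type (T · δ x)
      ; mono  = λ x x′ → Hom.trans
          (hom-mono (proj₁ (LTδ≋x x)) (proj₁ (x≋Rδ x′)))
          (fromX (T · δ x) (δ x′))
      }

    F : QFunctor X (Fix (T ∘F S))
    F = corestrict Tδ (λ x → T-fixed′ (ob (δ x)))

    G : QFunctor (Fix (T ∘F S)) X
    G = L ∘F inclusion

    GF≅1 : G ∘F F ≅F idF
    GF≅1 = (λ x → proj₁ (iso x)) , (λ x → proj₂ (iso x))
      where
      iso : ∀ x → X [ map (G ∘F F) x ≅ x ]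
      iso x = ≋⇒≅ (LTδ≋x x)

    FG≅1 : F ∘F G ≅F idF
    FG≅1 = (λ c → proj₁ (iso c)) , (λ c → proj₂ (iso c))
      where
      iso : ∀ c → Fix (T ∘F S) [ map (F ∘F G) c ≅ c ]
      iso (c₀ , TSc≅c) = ≋⇒≅ (⊑-trans Td⊑TSc (proj₁ (≅⇒≋ TSc≅c)) , c⊑Td)
        where
        x : Ob X
        x = map L c₀

        d : Typed D (QCategory.∣_∣ X x)
        d = δ x

        -- c₀ with the type of Lc₀, so that L · c is x up to its type proof.
        c : Typed C (QCategory.∣_∣ X x)
        c = c₀ ∶ sym (typed L c₀)

        c⊑Td : c ⊑ T · d
        c⊑Td = ⊑T (⊑-trans (⊑-same _ _) (proj₁ (x≋Rδ x)))

        Td⊑TSc : T · d ⊑ T · S · c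
        Td⊑TSc = ⊑T (⊑-trans (proj₁ (LTδ≋x x))
                             (⊑-trans (⊑-same _ _) (L⊑R (η c))))

theorem3p3 : ∀ {o c ℓ₁ ℓ₂ ι a b} (Q : Quantaloid o c ℓ₁ ℓ₂ ι)
    (C : QCategory Q a) (D : QCategory Q b)
    (S : QFunctor C D) (T : QFunctor D C) → S ⊣ T →
    (X : QCategory Q ι) →
    (X ≃ Fix (T ∘F S)) ⇔
    (Σ[ L ∈ QFunctor C X ] Σ[ R ∈ QFunctor D X ]
    (EssentiallySurjective L × EssentiallySurjective R ×
    graph S ≈D cograph R ⊙ graph L))
theorem3p3 Q C D S T S⊣T X = mk⇔
  (λ (F , G , GF≅1 , FG≅1) →
    let open FromEquivalence S T S⊣T F G GF≅1 FG≅1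
    in L , R , L-surjective , R-surjective , factorization)
  (λ (L , R , L-surjective , R-surjective , factorization) →
    let open FromFactorization S T S⊣T L R L-surjective R-surjective factorization
    in F , G , GF≅1 , FG≅1)
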